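{- Let $\mathbf{y}=(y_0,y_1,y_2)$ be a triple of positive integers with $y_0y_1y_2$ square-free, and let $r\geq 3$ be an integer. Then $$ \frac{N_{\mathbf{y}}^*(2^r)}{2^{2r}}=\begin{cases} 1, &\text{if } 2\nmid y_0y_1y_2 \text{ and it is not the case that } y_0 \equiv y_1 \equiv -y_2 \pmod 4,\\ 2, &\text{if } 2\mid y_0 \text{ and } y_1\equiv y_2 \pmod 8,\\ 2, &\text{if } 2\mid y_1 \text{ and } y_0\equiv y_2 \pmod 8,\\ 2, &\text{if } 2\mid y_2 \text{ and } y_0\equiv -y_1 \pmod 8,\\ 0, & \text{otherwise}. \end{cases} $$
   Context: For $r\geq 1$, $N_{\mathbf{y}}^*(2^r)$ is the number of $\mathbf{x}=(x_0,x_1,x_2)\in(\mathbf{Z}/2^r\mathbf{Z})^3\setminus(2\mathbf{Z}/2^r\mathbf{Z})^3$ such that $y_0^3x_0^2+y_1^3x_1^2\equiv y_2^3x_2^2\pmod{2^r}$ and $\min_{0\leq i\leq 2}\{v_2(x_iy_i)\}=0$, i.e. $2\nmid x_iy_i$ for at least one $i\in\{0,1,2\}$. -}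

module Defs where

open import Data.Nat using (ℕ; _+_; _*_; _^_)
import Data.Nat.Divisibility as ℕ
open import Data.Nat.Properties using (m^n≢0)
open import Data.Integer as ℤ using (ℤ; +_)
import Data.Integer.Divisibility as ℤ
open import Data.Rational using (ℚ; _/_)
open import Data.Fin using (Fin; toℕ)
open import Data.List using (List; length; filter; allFin; cartesianProduct)
open import Data.Product using (_×_; _,_)
open import Data.Sum using (_⊎_)
open import Relation.Nullary using (¬_)
open import Relation.Nullary.Decidable using (¬?; _×-dec_; _⊎-dec_)
open import Relation.Unary using (Decidable)
open import Relation.Binary.PropositionalEquality using (_≡_)

infix 4 _≡_[mod_]

_≡_[mod_] : ℤ → ℤ → ℕ → Set
a ≡ b [mod n ] = + n ℤ.∣ a ℤ.- b

SquareFree : ℕ → Set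
SquareFree n = ∀ d → d * d ℕ.∣ n → d ≡ 1

Triple : Set → Set
Triple A = A × A × A

-- Residue classes modulo 2 ^ r are represented by elements of Fin (2 ^ r).
-- The parity conditions below do not depend on the representative when r ≥ 1.
Residue : ℕ → Set
Residue r = Fin (2 ^ r)

allResidueTriples : ∀ r → List (Triple (Residue r))
allResidueTriples r = cartesianProduct (allFin _) (cartesianProduct (allFin _) (allFin _))

AllEven : ∀ r → Triple (Residue r) → Set
AllEven r (x₀ , x₁ , x₂) = 2 ℕ.∣ toℕ x₀ × 2 ℕ.∣ toℕ x₁ × 2 ℕ.∣ toℕ x₂

Solves : Triple ℕ → ∀ r → Triple (Residue r) → Set
Solves (y₀ , y₁ , y₂) r (x₀ , x₁ , x₂) =
  + (y₀ ^ 3 * toℕ x₀ ^ 2 + y₁ ^ 3 * toℕ x₁ ^ 2) ≡ + (y₂ ^ 3 * toℕ x₂ ^ 2) [mod 2 ^ r ]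

-- min { v₂ (xᵢ yᵢ) } = 0
SomeProductOdd : Triple ℕ → ∀ r → Triple (Residue r) → Set
SomeProductOdd (y₀ , y₁ , y₂) r (x₀ , x₁ , x₂) =
  ¬ 2 ℕ.∣ toℕ x₀ * y₀ ⊎ ¬ 2 ℕ.∣ toℕ x₁ * y₁ ⊎ ¬ 2 ℕ.∣ toℕ x₂ * y₂

Counted : Triple ℕ → ∀ r → Triple (Residue r) → Set
Counted y r x = ¬ AllEven r x × Solves y r x × SomeProductOdd y r x

counted? : ∀ y r → Decidable (Counted y r)
counted? (y₀ , y₁ , y₂) r (x₀ , x₁ , x₂) =
  ¬? ((2 ℕ.∣? toℕ x₀) ×-dec (2 ℕ.∣? toℕ x₁) ×-dec (2 ℕ.∣? toℕ x₂))
  ×-dec (2 ^ r ℕ.∣? _)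
  ×-dec (¬? (2 ℕ.∣? toℕ x₀ * y₀) ⊎-dec ¬? (2 ℕ.∣? toℕ x₁ * y₁) ⊎-dec ¬? (2 ℕ.∣? toℕ x₂ * y₂))

N* : Triple ℕ → ℕ → ℕ
N* y r = length (filter (counted? y r) (allResidueTriples r))

N*/2^2r : Triple ℕ → ℕ → ℚ
N*/2^2r y r = _/_ (+ N* y r) (2 ^ (2 * r)) {{m^n≢0 2 (2 * r)}}

OddCase : Triple ℕ → Set
OddCase (y₀ , y₁ , y₂) =
  ¬ 2 ℕ.∣ y₀ * y₁ * y₂ × ¬ (+ y₀ ≡ + y₁ [mod 4 ] × + y₁ ≡ ℤ.- (+ y₂) [mod 4 ])

EvenCase₀ EvenCase₁ EvenCase₂ : Triple ℕ → Set
EvenCase₀ (y₀ , y₁ , y₂) = 2 ℕ.∣ y₀ × + y₁ ≡ + y₂ [mod 8 ]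
EvenCase₁ (y₀ , y₁ , y₂) = 2 ℕ.∣ y₁ × + y₀ ≡ + y₂ [mod 8 ]
EvenCase₂ (y₀ , y₁ , y₂) = 2 ℕ.∣ y₂ × + y₀ ≡ ℤ.- (+ y₁) [mod 8 ]

{-# OPTIONS --safe #-}
module Submission where

-- For an odd and the level m = 2^k with k ≥ 3, shifting an odd x by m/2 changes a x² + w by an odd
-- multiple of m.  Hence exactly one of x, x + m/2 lifts a zero modulo m to a zero modulo 2m, and by
-- descent to modulus 8 the congruence a x² + w ≡ 0 (mod 2^r) has 4 odd solutions x if 8 ∣ a + w
-- and none otherwise.  Parity leaves exactly two of the xᵢ odd when y₀y₁y₂ is odd, and forces the two xᵢ
-- with yᵢ odd to be odd otherwise; solving for one odd variable reduces both counts to conditions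
-- modulo 8.  Since y³ ≡ y (mod 8) for odd y, these are conditions on y itself.

open import Defs
open import Data.Nat using (ℕ; _*_; _<_; _≤_)
open import Data.Integer using (+_)
open import Data.Rational using (_/_; 0ℚ; 1ℚ)
open import Data.Product using (_×_; _,_)
open import Data.Sum using (_⊎_)
open import Relation.Nullary using (¬_)
open import Relation.Binary.PropositionalEquality using (_≡_)

import Algebra.Properties.Semiring.Sum as SemiringSum
open import Data.Bool using (true; false; if_then_else_)
open import Data.Fin as Fin using (Fin; toℕ)
import Data.Integer as ℤ
open ℤ using (ℤ)
import Data.Integer.DivMod as ℤ
import Data.Integer.Properties as ℤ
open import Data.Integer.Divisibility.Signed
open import Data.Integer.Tactic.RingSolver using (solve-∀)
open import Data.List using (List; []; _∷_; _++_; length; filter; map; tabulate; cartesianProduct)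
open import Data.List.Properties using (filter-++; length-++)
open import Data.Nat as ℕ using (zero; suc; _+_; _^_; s≤s)
import Data.Nat.Divisibility as ℕ
open import Data.Nat.Primality using (euclidsLemma; prime[2])
import Data.Nat.Properties as ℕ
import Data.Nat.Tactic.RingSolver as ℕ
open import Data.Product using (∃; proj₁; proj₂)
open import Data.Rational.Properties using (fromℚᵘ-cong)
open import Data.Rational.Unnormalised using (mkℚᵘ; *≡*)
open import Data.Sum using (inj₁; inj₂; [_,_]′)
open import Function using (_∘_; const)
open import Level using (0ℓ)
open import Relation.Nullary using (Dec; yes; no; does; contradiction)
open import Relation.Nullary.Decidable using (¬?; _×-dec_; _⊎-dec_; decidable-stable; _because_)
open import Relation.Unary using (Pred; Decidable)
open import Relation.Binary.PropositionalEquality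
  using (refl; sym; trans; cong; cong₂; subst; module ≡-Reasoning)

open SemiringSum ℕ.+-*-semiring
  using (sum; sum-cong-≗; ∑-distrib-+; ∑-comm; *-distribˡ-sum)
open ≡-Reasoning

private variable
  P Q : Set

𝟙 : Dec P → ℕ
𝟙 d = if does d then 1 else 0

𝟙-yes : (d : Dec P) → P → 𝟙 d ≡ 1
𝟙-yes (yes _) _ = refl
𝟙-yes (no ¬p) p = contradiction p ¬p

𝟙-no : (d : Dec P) → ¬ P → 𝟙 d ≡ 0
𝟙-no (yes p) ¬p = contradiction p ¬p
𝟙-no (no _)  _  = refl

𝟙-cong : (p : Dec P) (q : Dec Q) → (P → Q) → (Q → P) → 𝟙 p ≡ 𝟙 q
𝟙-cong p (yes b) _ g = 𝟙-yes p (g b)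
𝟙-cong p (no ¬b) f _ = 𝟙-no p (¬b ∘ f)

𝟙-× : (p : Dec P) (q : Dec Q) → 𝟙 (p ×-dec q) ≡ 𝟙 p * 𝟙 q
𝟙-× (yes _) q = sym (ℕ.+-identityʳ (𝟙 q))
𝟙-× (no _)  _ = refl

𝟙-⊎ : (p : Dec P) (q : Dec Q) → ¬ (P × Q) → 𝟙 (p ⊎-dec q) ≡ 𝟙 p + 𝟙 q
𝟙-⊎ (yes a) q ¬pq = cong suc (sym (𝟙-no q (¬pq ∘ (a ,_))))
𝟙-⊎ (no _)  q _   = refl

∑ : ℕ → (ℕ → ℕ) → ℕ
∑ n f = sum {n} (f ∘ toℕ)

∑-syntax = ∑
syntax ∑-syntax n (λ i → e) = ∑[ i < n ] e
infix 5 ∑-syntax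

∑-cong : ∀ n {f g : ℕ → ℕ} → (∀ i → f i ≡ g i) → ∑ n f ≡ ∑ n g
∑-cong n f≗g = sum-cong-≗ {n} (f≗g ∘ toℕ)

∑-distrib : ∀ n (f g : ℕ → ℕ) → ∑[ i < n ] (f i + g i) ≡ ∑ n f + ∑ n g
∑-distrib n f g = ∑-distrib-+ {n} (f ∘ toℕ) (g ∘ toℕ)

∑-swap : ∀ m n (f : ℕ → ℕ → ℕ) → ∑[ i < m ] ∑[ j < n ] f i j ≡ ∑[ j < n ] ∑[ i < m ] f i j
∑-swap m n f = ∑-comm {m} {n} (λ i j → f (toℕ i) (toℕ j))

∑-*ˡ : ∀ n c (f : ℕ → ℕ) → ∑[ i < n ] (c * f i) ≡ c * ∑ n f
∑-*ˡ n c f = sym (*-distribˡ-sum {n} c (f ∘ toℕ))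

∑-*ʳ : ∀ n c (f : ℕ → ℕ) → ∑[ i < n ] (f i * c) ≡ ∑ n f * c
∑-*ʳ n c f = trans (∑-cong n λ i → ℕ.*-comm (f i) c) (trans (∑-*ˡ n c f) (ℕ.*-comm c _))

∑-const : ∀ n c → ∑[ _ < n ] c ≡ n * c
∑-const zero    c = refl
∑-const (suc n) c = cong (_+_ c) (∑-const n c)

∑-+ : ∀ m n (f : ℕ → ℕ) → ∑ (m + n) f ≡ ∑ m f + (∑[ i < n ] f (m + i))
∑-+ zero    n f = refl
∑-+ (suc m) n f = trans (cong (_+_ (f 0)) (∑-+ m n (f ∘ suc))) (sym (ℕ.+-assoc (f 0) _ _))

∑-periodic : ∀ m p (f : ℕ → ℕ) → (∀ i → f (p + i) ≡ f i) → ∑ (m * p) f ≡ m * ∑ p f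
∑-periodic zero    p f f≗ = refl
∑-periodic (suc m) p f f≗ = trans (∑-+ p (m * p) f)
  (cong (_+_ (∑ p f)) (trans (∑-cong (m * p) f≗) (∑-periodic m p f f≗)))

length-filter-tabulate : ∀ {A : Set} {P : Pred A 0ℓ} (P? : Decidable P) {n} (f : Fin n → A) →
  length (filter P? (tabulate f)) ≡ sum (λ i → 𝟙 (P? (f i)))
length-filter-tabulate P? {zero}  f = refl
length-filter-tabulate P? {suc n} f with P? (f Fin.zero)
... | true  because _ = cong suc (length-filter-tabulate P? (f ∘ Fin.suc))
... | false because _ = length-filter-tabulate P? (f ∘ Fin.suc)

length-filter-map : ∀ {A B : Set} {P : Pred B 0ℓ} (P? : Decidable P) (f : A → B) xs →
  length (filter P? (map f xs)) ≡ length (filter (P? ∘ f) xs)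
length-filter-map P? f [] = refl
length-filter-map P? f (x ∷ xs) with does (P? (f x))
... | true  = cong suc (length-filter-map P? f xs)
... | false = length-filter-map P? f xs

length-filter-cartesianProduct : ∀ {A B : Set} {P : Pred (A × B) 0ℓ} (P? : Decidable P)
  {n} (f : Fin n → A) (ys : List B) →
  length (filter P? (cartesianProduct (tabulate f) ys)) ≡
  sum (λ i → length (filter (λ y → P? (f i , y)) ys))
length-filter-cartesianProduct P? {zero}  f ys = refl
length-filter-cartesianProduct P? {suc n} f ys = begin
  length (filter P? (map (x ,_) ys ++ rest))                   ≡⟨ cong length (filter-++ P? (map (x ,_) ys) rest) ⟩
  length (filter P? (map (x ,_) ys) ++ filter P? rest)         ≡⟨ length-++ (filter P? (map (x ,_) ys)) ⟩
  length (filter P? (map (x ,_) ys)) + length (filter P? rest)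
    ≡⟨ cong₂ _+_ (length-filter-map P? (x ,_) ys) (length-filter-cartesianProduct P? (f ∘ Fin.suc) ys) ⟩
  _ ∎
  where
  x = f Fin.zero
  rest = cartesianProduct (tabulate (f ∘ Fin.suc)) ys

N*≡∑ : ∀ y r (c : ℕ → ℕ → ℕ → ℕ) →
  (∀ i j k → 𝟙 (counted? y r (i , j , k)) ≡ c (toℕ i) (toℕ j) (toℕ k)) →
  N* y r ≡ (∑[ i < 2 ^ r ] ∑[ j < 2 ^ r ] ∑[ k < 2 ^ r ] c i j k)
N*≡∑ y r c eq =
  trans (length-filter-cartesianProduct (counted? y r) {2 ^ r} (λ i → i) _)
  (sum-cong-≗ {2 ^ r} λ i →
    trans (length-filter-cartesianProduct (λ jk → counted? y r (i , jk)) {2 ^ r} (λ j → j) _)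
    (sum-cong-≗ {2 ^ r} λ j →
      trans (length-filter-tabulate (λ k → counted? y r (i , j , k)) {2 ^ r} (λ k → k))
      (sum-cong-≗ {2 ^ r} (eq i j))))

Even Odd : ℤ → Set
Even i = + 2 ∣ i
Odd i = ¬ Even i

even? : ∀ i → Dec (Even i)
even? i = + 2 ∣? i

even⊎pred-even : ∀ i → Even i ⊎ Even (i ℤ.- + 1)
even⊎pred-even i with i ℤ.% + 2 | ℤ.n%d<d i (+ 2) | ℤ.a≡a%n+[a/n]*n i (+ 2)
... | 0 | _ | eq = inj₁ (divides (i ℤ./ + 2) (trans eq (ℤ.+-identityˡ (i ℤ./ + 2 ℤ.* + 2))))
... | 1 | _ | eq = inj₂ (divides (i ℤ./ + 2) (trans (cong (ℤ._- + 1) eq) (lemma (i ℤ./ + 2 ℤ.* + 2))))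
  where
  lemma : ∀ a → (+ 1 ℤ.+ a) ℤ.- + 1 ≡ a
  lemma = solve-∀
... | suc (suc _) | s≤s (s≤s ()) | _

odd⇒pred-even : ∀ {i} → Odd i → Even (i ℤ.- + 1)
odd⇒pred-even {i} oi = [ (λ e → contradiction e oi) , (λ e → e) ]′ (even⊎pred-even i)

pred-even⇒odd : ∀ {i} → Even (i ℤ.- + 1) → Odd i
pred-even⇒odd e' e with ∣⇒∣ᵤ (∣m+n∣m⇒∣n e' e)
... | d with ℕ.∣⇒≤ d
... | s≤s ()

∣-resp : ∀ {m i j} → i ≡ j → m ∣ i → m ∣ j
∣-resp refl d = d

odd*odd : ∀ {i j} → Odd i → Odd j → Odd (i ℤ.* j)
odd*odd {i} {j} oi oj = pred-even⇒odd (∣-resp (lemma i j)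
  (∣m∣n⇒∣m+n (∣m⇒∣m*n j (odd⇒pred-even oi)) (odd⇒pred-even oj)))
  where
  lemma : ∀ i j → (i ℤ.- + 1) ℤ.* j ℤ.+ (j ℤ.- + 1) ≡ i ℤ.* j ℤ.- + 1
  lemma = solve-∀

odd+odd : ∀ {i j} → Odd i → Odd j → Even (i ℤ.+ j)
odd+odd {i} {j} oi oj = ∣-resp (lemma i j)
  (∣m∣n⇒∣m+n (∣m∣n⇒∣m+n (odd⇒pred-even oi) (odd⇒pred-even oj)) (∣-refl {+ 2}))
  where
  lemma : ∀ i j → (i ℤ.- + 1) ℤ.+ (j ℤ.- + 1) ℤ.+ + 2 ≡ i ℤ.+ j
  lemma = solve-∀

even+odd : ∀ {i j} → Even i → Odd j → Odd (i ℤ.+ j)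
even+odd ei oj e = oj (∣m+n∣m⇒∣n e ei)

odd+even : ∀ {i j} → Odd i → Even j → Odd (i ℤ.+ j)
odd+even oi ej e = oi (∣m+n∣n⇒∣m e ej)

odd-neg : ∀ {i} → Odd i → Odd (ℤ.- i)
odd-neg {i} oi e = oi (∣-resp (ℤ.neg-involutive i) (∣m⇒∣-m e))

sq : ℕ → ℤ
sq x = + x ℤ.* + x

odd-sq : ∀ {i} → Odd i → + 8 ∣ i ℤ.* i ℤ.- + 1
odd-sq {i} oi with odd⇒pred-even oi
... | divides q eq with even⊎pred-even q
... | inj₁ (divides s refl) = divides (s ℤ.+ + 2 ℤ.* s ℤ.* s) (trans (cong (λ j → j ℤ.* j ℤ.- + 1) i≡) (lemma s))
  where
  back : ∀ i → i ≡ i ℤ.- + 1 ℤ.+ + 1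
  back = solve-∀
  i≡ = trans (back i) (cong (ℤ._+ + 1) eq)
  lemma : ∀ s → (s ℤ.* + 2 ℤ.* + 2 ℤ.+ + 1) ℤ.* (s ℤ.* + 2 ℤ.* + 2 ℤ.+ + 1) ℤ.- + 1 ≡ (s ℤ.+ + 2 ℤ.* s ℤ.* s) ℤ.* + 8
  lemma = solve-∀
... | inj₂ (divides s eq′) = divides (+ 2 ℤ.* s ℤ.* s ℤ.+ + 3 ℤ.* s ℤ.+ + 1) (trans (cong (λ j → j ℤ.* j ℤ.- + 1) i≡) (lemma s))
  where
  back : ∀ i → i ≡ i ℤ.- + 1 ℤ.+ + 1
  back = solve-∀
  q≡ = trans (back q) (cong (ℤ._+ + 1) eq′)
  i≡ = trans (back i) (cong (ℤ._+ + 1) (trans eq (cong (ℤ._* + 2) q≡)))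
  lemma : ∀ s → ((s ℤ.* + 2 ℤ.+ + 1) ℤ.* + 2 ℤ.+ + 1) ℤ.* ((s ℤ.* + 2 ℤ.+ + 1) ℤ.* + 2 ℤ.+ + 1) ℤ.- + 1 ≡
    (+ 2 ℤ.* s ℤ.* s ℤ.+ + 3 ℤ.* s ℤ.+ + 1) ℤ.* + 8
  lemma = solve-∀

[_∣_] : ℤ → ℤ → ℕ
[ m ∣ i ] = 𝟙 (m ∣? i)

∣-shift : ∀ {m i} j → m ∣ i ℤ.- j → m ∣ j → m ∣ i
∣-shift {i = i} j d e = ∣-resp (lemma i j) (∣m∣n⇒∣m+n d e)
  where
  lemma : ∀ i j → i ℤ.- j ℤ.+ j ≡ i
  lemma = solve-∀

∣-flip : ∀ {m} i j → m ∣ i ℤ.- j → m ∣ j ℤ.- i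
∣-flip i j d = ∣-resp (lemma i j) (∣m⇒∣-m d)
  where
  lemma : ∀ i j → ℤ.- (i ℤ.- j) ≡ j ℤ.- i
  lemma = solve-∀

[∣]-cong : ∀ m i j → m ∣ i ℤ.- j → [ m ∣ i ] ≡ [ m ∣ j ]
[∣]-cong m i j d = 𝟙-cong (m ∣? i) (m ∣? j) (∣-shift i (∣-flip i j d)) (∣-shift j d)

parity-flip : ∀ q {t} → Odd t → [ + 2 ∣ q ] + [ + 2 ∣ q ℤ.+ t ] ≡ 1
parity-flip q {t} ot with even? q
... | yes e = cong₂ _+_ (𝟙-yes (even? q) e) (𝟙-no (even? (q ℤ.+ t)) (even+odd e ot))
... | no  o = cong₂ _+_ (𝟙-no (even? q) o) (𝟙-yes (even? (q ℤ.+ t)) (odd+odd o ot))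

-- Among the two lifts of a class modulo m to classes modulo 2m, exactly one is the zero class.
lift-unique : ∀ m .{{_ : ℤ.NonZero m}} z {t} → Odd t →
  [ + 2 ℤ.* m ∣ z ] + [ + 2 ℤ.* m ∣ z ℤ.+ m ℤ.* t ] ≡ [ m ∣ z ]
lift-unique m z {t} ot with m ∣? z
... | no ∤z = trans (cong₂ _+_
  (𝟙-no (+ 2 ℤ.* m ∣? z) (∤z ∘ ∣-trans m∣2m))
  (𝟙-no (+ 2 ℤ.* m ∣? (z ℤ.+ m ℤ.* t)) λ d → ∤z (∣m+n∣n⇒∣m (∣-trans m∣2m d) (∣m⇒∣m*n t ∣-refl))))
  (sym (𝟙-no (m ∣? z) ∤z))
  where
  m∣2m : m ∣ + 2 ℤ.* m
  m∣2m = divides (+ 2) refl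
... | yes (divides q refl) = trans (cong₂ _+_ (cancel q)
    (trans (cong [ + 2 ℤ.* m ∣_] (lemma q m t)) (cancel (q ℤ.+ t))))
    (trans (parity-flip q ot) (sym (𝟙-yes (m ∣? q ℤ.* m) (divides q refl))))
  where
  lemma : ∀ q m t → q ℤ.* m ℤ.+ m ℤ.* t ≡ (q ℤ.+ t) ℤ.* m
  lemma = solve-∀
  cancel : ∀ q → [ + 2 ℤ.* m ∣ q ℤ.* m ] ≡ [ + 2 ∣ q ]
  cancel q = 𝟙-cong (+ 2 ℤ.* m ∣? q ℤ.* m) (even? q) (*-cancelʳ-∣ m) (*-monoˡ-∣ m)

even odd : ℕ → ℕ
even x = 𝟙 (even? (+ x))
odd x = 𝟙 (¬? (even? (+ x)))

Even-+2* : ∀ g x → (Even (+ (2 * g + x)) → Even (+ x)) × (Even (+ x) → Even (+ (2 * g + x)))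
Even-+2* g x = (λ d → ∣m+n∣m⇒∣n (∣-resp (ℤ.pos-+ (2 * g) x) d) e) , (λ d → ∣-resp (sym (ℤ.pos-+ (2 * g) x)) (∣m∣n⇒∣m+n e d))
  where
  e : Even (+ (2 * g))
  e = ∣-resp (sym (ℤ.pos-* 2 g)) (∣m⇒∣m*n (+ g) ∣-refl)

even-+2* : ∀ g x → even (2 * g + x) ≡ even x
even-+2* g x = 𝟙-cong (even? (+ (2 * g + x))) (even? (+ x)) (proj₁ (Even-+2* g x)) (proj₂ (Even-+2* g x))

odd-+2* : ∀ g x → odd (2 * g + x) ≡ odd x
odd-+2* g x = 𝟙-cong (¬? (even? (+ (2 * g + x)))) (¬? (even? (+ x))) (_∘ proj₂ (Even-+2* g x)) (_∘ proj₁ (Even-+2* g x))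

odd-weight : ∀ x {m n} → (Odd (+ x) → m ≡ n) → odd x * m ≡ odd x * n
odd-weight x {m} {n} f with even? (+ x)
... | yes e = trans (cong (_* m) z) (sym (cong (_* n) z))
  where
  z : odd x ≡ 0
  z = 𝟙-no (¬? (even? (+ x))) (λ o → o e)
... | no  o = cong (odd x *_) (f o)

∑-double : ∀ n (f : ℕ → ℕ) → ∑ (2 * n) f ≡ (∑[ i < n ] (f i + f (n + i)))
∑-double n f = begin
  ∑ (n + (n + 0)) f                    ≡⟨ cong (λ k → ∑ (n + k) f) (ℕ.+-identityʳ n) ⟩
  ∑ (n + n) f                          ≡⟨ ∑-+ n n f ⟩
  ∑ n f + (∑[ i < n ] f (n + i))       ≡⟨ ∑-distrib n f (λ i → f (n + i)) ⟨
  (∑[ i < n ] (f i + f (n + i)))       ∎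

module _ (a w : ℤ) (oa : Odd a) where

  private
    F : ℕ → ℤ
    F x = a ℤ.* sq x ℤ.+ w

  F-shift : ∀ g x → F (2 * (2 * g) + x) ≡
    F x ℤ.+ + (2 * (2 * (2 * g))) ℤ.* (a ℤ.* (+ x ℤ.+ + 2 ℤ.* + g))
  F-shift g x = trans
    (cong (λ h → a ℤ.* ((h ℤ.+ + x) ℤ.* (h ℤ.+ + x)) ℤ.+ w) 4g)
    (trans (lemma a w (+ g) (+ x)) (cong (λ h → F x ℤ.+ h ℤ.* (a ℤ.* (+ x ℤ.+ + 2 ℤ.* + g))) (sym 8g)))
    where
    4g : + (2 * (2 * g)) ≡ + 2 ℤ.* (+ 2 ℤ.* + g)
    4g = trans (ℤ.pos-* 2 (2 * g)) (cong (+ 2 ℤ.*_) (ℤ.pos-* 2 g))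
    8g : + (2 * (2 * (2 * g))) ≡ + 2 ℤ.* (+ 2 ℤ.* (+ 2 ℤ.* + g))
    8g = trans (ℤ.pos-* 2 (2 * (2 * g))) (cong (+ 2 ℤ.*_) 4g)
    lemma : ∀ a w g x → a ℤ.* ((+ 2 ℤ.* (+ 2 ℤ.* g) ℤ.+ x) ℤ.* (+ 2 ℤ.* (+ 2 ℤ.* g) ℤ.+ x)) ℤ.+ w ≡
      (a ℤ.* (x ℤ.* x) ℤ.+ w) ℤ.+ (+ 2 ℤ.* (+ 2 ℤ.* (+ 2 ℤ.* g))) ℤ.* (a ℤ.* (x ℤ.+ + 2 ℤ.* g))
    lemma = solve-∀

  halfCount : ℕ → ℕ
  halfCount k = ∑[ x < 2 ^ k ] odd x * [ + (2 ^ suc k) ∣ F x ]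

  halfCount-step : ∀ j → halfCount (3 + j) ≡ halfCount (2 + j)
  halfCount-step j = trans (∑-double (2 ^ (2 + j)) f) (∑-cong (2 ^ (2 + j)) pointwise)
    where
    g h : ℕ
    g = 2 ^ j
    h = 2 * (2 * g)
    m : ℤ
    m = + (2 * h)
    f : ℕ → ℕ
    f x = odd x * [ + (2 * (2 * h)) ∣ F x ]
    instance
      m≢0 : ℤ.NonZero m
      m≢0 = ℕ.m^n≢0 2 (3 + j)
    pointwise : ∀ x → f x + f (h + x) ≡ odd x * [ m ∣ F x ]
    pointwise x = begin
      f x + odd (h + x) * M     ≡⟨ cong (λ o → f x + o * M) (odd-+2* (2 * g) x) ⟩
      odd x * L + odd x * M     ≡⟨ ℕ.*-distribˡ-+ (odd x) L M ⟨
      odd x * (L + M)           ≡⟨ odd-weight x step ⟩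
      odd x * [ m ∣ F x ]       ∎
      where
      L M : ℕ
      L = [ + (2 * (2 * h)) ∣ F x ]
      M = [ + (2 * (2 * h)) ∣ F (h + x) ]
      t : ℤ
      t = a ℤ.* (+ x ℤ.+ + 2 ℤ.* + g)
      step : Odd (+ x) → L + M ≡ [ m ∣ F x ]
      step ox = begin
        L + M ≡⟨ cong₂ (λ n z → [ n ∣ F x ] + [ n ∣ z ]) (ℤ.pos-* 2 (2 * h)) (F-shift g x) ⟩
        [ + 2 ℤ.* m ∣ F x ] + [ + 2 ℤ.* m ∣ F x ℤ.+ m ℤ.* t ]
          ≡⟨ lift-unique m (F x) (odd*odd oa (odd+even ox (∣m⇒∣m*n (+ g) ∣-refl))) ⟩
        [ m ∣ F x ] ∎

  halfCount-const : ∀ j → halfCount (2 + j) ≡ halfCount 2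
  halfCount-const zero    = refl
  halfCount-const (suc j) = trans (halfCount-step j) (halfCount-const j)

  halfCount-base : halfCount 2 ≡ 2 * [ + 8 ∣ a ℤ.+ w ]
  halfCount-base = trans
    (cong₂ (λ m n → m + 0 + (n + 0 + 0)) (residue (+ 0) (F 1) (at-1 a w)) (residue a (F 3) (at-3 a w)))
    (double [ + 8 ∣ a ℤ.+ w ])
    where
    residue : ∀ q z → z ≡ a ℤ.+ w ℤ.+ q ℤ.* + 8 → [ + 8 ∣ z ] ≡ [ + 8 ∣ a ℤ.+ w ]
    residue q z eq = [∣]-cong (+ 8) z (a ℤ.+ w) (divides q (trans (cong (ℤ._- (a ℤ.+ w)) eq) (lemma (a ℤ.+ w) _)))
      where
      lemma : ∀ u v → u ℤ.+ v ℤ.- u ≡ v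
      lemma = solve-∀
    at-1 : ∀ a w → a ℤ.* + 1 ℤ.+ w ≡ a ℤ.+ w ℤ.+ + 0 ℤ.* + 8
    at-1 = solve-∀
    at-3 : ∀ a w → a ℤ.* + 9 ℤ.+ w ≡ a ℤ.+ w ℤ.+ a ℤ.* + 8
    at-3 = solve-∀
    double : ∀ d → d + 0 + (d + 0 + 0) ≡ 2 * d
    double = ℕ.solve-∀

  ∑-odd-square : ∀ j → (∑[ x < 2 ^ (3 + j) ] odd x * [ + (2 ^ (3 + j)) ∣ F x ]) ≡ 4 * [ + 8 ∣ a ℤ.+ w ]
  ∑-odd-square j = begin
    ∑ (2 * h) f                 ≡⟨ ∑-periodic 2 h f periodic ⟩
    2 * halfCount (2 + j)       ≡⟨ cong (2 *_) (trans (halfCount-const j) halfCount-base) ⟩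
    2 * (2 * [ + 8 ∣ a ℤ.+ w ]) ≡⟨ ℕ.*-assoc 2 2 [ + 8 ∣ a ℤ.+ w ] ⟨
    4 * [ + 8 ∣ a ℤ.+ w ]       ∎
    where
    g h : ℕ
    g = 2 ^ j
    h = 2 * (2 * g)
    f : ℕ → ℕ
    f x = odd x * [ + (2 * h) ∣ F x ]
    periodic : ∀ x → f (h + x) ≡ f x
    periodic x = cong₂ _*_ (odd-+2* (2 * g) x)
      ([∣]-cong (+ (2 * h)) (F (h + x)) (F x)
        (∣-resp (sym (trans (cong (ℤ._- F x) (F-shift g x)) (lemma (F x) _))) (∣m⇒∣m*n t ∣-refl)))
      where
      t : ℤ
      t = a ℤ.* (+ x ℤ.+ + 2 ℤ.* + g)
      lemma : ∀ u v → u ℤ.+ v ℤ.- u ≡ v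
      lemma = solve-∀

∑-odd : ∀ n → ∑ (2 * n) odd ≡ n
∑-odd n = begin
  ∑ (2 * n) odd  ≡⟨ cong (λ k → ∑ k odd) (ℕ.*-comm 2 n) ⟩
  ∑ (n * 2) odd  ≡⟨ ∑-periodic n 2 odd (odd-+2* 1) ⟩
  n * 1          ≡⟨ ℕ.*-identityʳ n ⟩
  n              ∎

∑-even-square : ∀ {A} → Odd A → ∀ E n →
  (∑[ u < 2 * (2 * n) ] even u * [ + 8 ∣ A ℤ.* sq u ℤ.+ E ]) ≡ n * [ + 4 ∣ E ]
∑-even-square {A} oA E n = begin
  ∑ (2 * (2 * n)) f ≡⟨ cong (λ k → ∑ k f) (lemma₁ n) ⟩
  ∑ (n * 4) f       ≡⟨ ∑-periodic n 4 f periodic ⟩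
  n * ∑ 4 f         ≡⟨ cong (n *_) base ⟩
  n * [ + 4 ∣ E ]   ∎
  where
  f : ℕ → ℕ
  f u = even u * [ + 8 ∣ A ℤ.* sq u ℤ.+ E ]
  lemma₁ : ∀ n → 2 * (2 * n) ≡ n * 4
  lemma₁ = ℕ.solve-∀
  lemma₂ : ∀ A E u → A ℤ.* ((+ 4 ℤ.+ u) ℤ.* (+ 4 ℤ.+ u)) ℤ.+ E ℤ.- (A ℤ.* (u ℤ.* u) ℤ.+ E) ≡
    A ℤ.* (u ℤ.+ + 2) ℤ.* + 8
  lemma₂ = solve-∀
  lemma₃ : ∀ A E → A ℤ.* + 4 ℤ.+ E ≡ E ℤ.+ + 4 ℤ.* A
  lemma₃ = solve-∀
  lemma₄ : ∀ A E → A ℤ.* + 0 ℤ.+ E ≡ E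
  lemma₄ = solve-∀
  lemma₅ : ∀ m n → m + 0 + (n + 0 + 0) ≡ m + n
  lemma₅ = ℕ.solve-∀
  periodic : ∀ u → f (4 + u) ≡ f u
  periodic u = cong₂ _*_ (even-+2* 2 u) ([∣]-cong (+ 8) (A ℤ.* sq (4 + u) ℤ.+ E) (A ℤ.* sq u ℤ.+ E)
    (divides (A ℤ.* (+ u ℤ.+ + 2)) (lemma₂ A E (+ u))))
  base : ∑ 4 f ≡ [ + 4 ∣ E ]
  base = begin
    ∑ 4 f
      ≡⟨ lemma₅ [ + 8 ∣ A ℤ.* + 0 ℤ.+ E ] [ + 8 ∣ A ℤ.* + 4 ℤ.+ E ] ⟩
    [ + 8 ∣ A ℤ.* + 0 ℤ.+ E ] + [ + 8 ∣ A ℤ.* + 4 ℤ.+ E ]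
      ≡⟨ cong₂ (λ a b → [ + 8 ∣ a ] + [ + 8 ∣ b ]) (lemma₄ A E) (lemma₃ A E) ⟩
    [ + 8 ∣ E ] + [ + 8 ∣ E ℤ.+ + 4 ℤ.* A ]
      ≡⟨ lift-unique (+ 4) E oA ⟩
    [ + 4 ∣ E ] ∎

∑³ : ℕ → (ℕ → ℕ → ℕ → ℕ) → ℕ
∑³ n f = ∑[ u < n ] ∑[ v < n ] ∑[ s < n ] f u v s

∑³-distrib : ∀ n f g → ∑³ n (λ u v s → f u v s + g u v s) ≡ ∑³ n f + ∑³ n g
∑³-distrib n f g =
  trans (∑-cong n λ u → trans (∑-cong n λ v → ∑-distrib n (f u v) (g u v))
                              (∑-distrib n (λ v → ∑ n (f u v)) (λ v → ∑ n (g u v))))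
        (∑-distrib n (λ u → ∑[ v < n ] ∑ n (f u v)) (λ u → ∑[ v < n ] ∑ n (g u v)))

∑³-swap₀₁ : ∀ n f → ∑³ n (λ u v s → f v u s) ≡ ∑³ n f
∑³-swap₀₁ n f = ∑-swap n n (λ u v → ∑ n (f v u))

∑³-rotate : ∀ n f → ∑³ n (λ u v s → f s u v) ≡ ∑³ n f
∑³-rotate n f = trans (∑-cong n λ u → ∑-swap n n (λ v s → f s u v))
                      (∑-swap n n (λ u s → ∑ n (f s u)))

Form : ℤ → ℤ → ℤ → ℕ → ℕ → ℕ → ℤ
Form A B C u v s = A ℤ.* sq u ℤ.+ B ℤ.* sq v ℤ.+ C ℤ.* sq s

Form-swap₀₁ : ∀ A B C u v s → Form A B C u v s ≡ Form B A C v u s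
Form-swap₀₁ A B C u v s = cong (ℤ._+ C ℤ.* sq s) (ℤ.+-comm (A ℤ.* sq u) (B ℤ.* sq v))

Form-rotate : ∀ A B C u v s → Form A B C u v s ≡ Form C A B s u v
Form-rotate A B C u v s = trans (ℤ.+-comm (A ℤ.* sq u ℤ.+ B ℤ.* sq v) (C ℤ.* sq s))
  (sym (ℤ.+-assoc (C ℤ.* sq s) (A ℤ.* sq u) (B ℤ.* sq v)))

weighted : (ℕ → ℕ) → ℕ → ℤ → ℤ → ℤ → ℕ → ℕ → ℕ → ℕ
weighted p n A B C u v s = p u * (odd v * (odd s * [ + n ∣ Form A B C u v s ]))

∑³-weighted : ∀ p A B {C} → Odd C → ∀ j →
  ∑³ (2 ^ (3 + j)) (weighted p (2 ^ (3 + j)) A B C) ≡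
  2 ^ (2 + j) * 4 * (∑[ u < 2 ^ (3 + j) ] p u * [ + 8 ∣ A ℤ.* sq u ℤ.+ (B ℤ.+ C) ])
∑³-weighted p A B {C} oC j = trans (∑-cong n sum-v) (∑-*ˡ n (h * 4) (λ u → p u * d u))
  where
  n h : ℕ
  n = 2 ^ (3 + j)
  h = 2 ^ (2 + j)
  d : ℕ → ℕ
  d u = [ + 8 ∣ A ℤ.* sq u ℤ.+ (B ℤ.+ C) ]

  lemma₁ : ∀ a b c → a ℤ.+ b ℤ.+ c ≡ c ℤ.+ (a ℤ.+ b)
  lemma₁ = solve-∀
  lemma₂ : ∀ C a B v → C ℤ.+ (a ℤ.+ B ℤ.* v) ℤ.- (a ℤ.+ (B ℤ.+ C)) ≡ B ℤ.* (v ℤ.- + 1)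
  lemma₂ = solve-∀
  lemma₃ : ∀ p h d → p * (h * (4 * d)) ≡ h * 4 * (p * d)
  lemma₃ = ℕ.solve-∀

  sum-s : ∀ u v → (∑[ s < n ] weighted p n A B C u v s) ≡ p u * (odd v * (4 * d u))
  sum-s u v = begin
    (∑[ s < n ] p u * (odd v * (odd s * [ + n ∣ Form A B C u v s ])))
      ≡⟨ ∑-*ˡ n (p u) (λ s → odd v * (odd s * [ + n ∣ Form A B C u v s ])) ⟩
    p u * (∑[ s < n ] odd v * (odd s * [ + n ∣ Form A B C u v s ]))
      ≡⟨ cong (p u *_) (∑-*ˡ n (odd v) (λ s → odd s * [ + n ∣ Form A B C u v s ])) ⟩
    p u * (odd v * (∑[ s < n ] odd s * [ + n ∣ Form A B C u v s ]))
      ≡⟨ cong (λ k → p u * (odd v * k)) (trans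
           (∑-cong n λ s → cong (λ z → odd s * [ + n ∣ z ]) (lemma₁ (A ℤ.* sq u) (B ℤ.* sq v) (C ℤ.* sq s)))
           (∑-odd-square C (A ℤ.* sq u ℤ.+ B ℤ.* sq v) oC j)) ⟩
    p u * (odd v * (4 * [ + 8 ∣ C ℤ.+ (A ℤ.* sq u ℤ.+ B ℤ.* sq v) ]))
      ≡⟨ cong (p u *_) (odd-weight v λ ov → cong (4 *_)
           ([∣]-cong (+ 8) (C ℤ.+ (A ℤ.* sq u ℤ.+ B ℤ.* sq v)) (A ℤ.* sq u ℤ.+ (B ℤ.+ C))
             (∣-resp (sym (lemma₂ C (A ℤ.* sq u) B (sq v))) (∣n⇒∣m*n B (odd-sq ov))))) ⟩
    p u * (odd v * (4 * d u)) ∎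

  sum-v : ∀ u → (∑[ v < n ] ∑[ s < n ] weighted p n A B C u v s) ≡ h * 4 * (p u * d u)
  sum-v u = begin
    (∑[ v < n ] ∑[ s < n ] weighted p n A B C u v s) ≡⟨ ∑-cong n (sum-s u) ⟩
    (∑[ v < n ] p u * (odd v * (4 * d u)))            ≡⟨ ∑-*ˡ n (p u) (λ v → odd v * (4 * d u)) ⟩
    p u * (∑[ v < n ] odd v * (4 * d u))              ≡⟨ cong (p u *_) (∑-*ʳ n (4 * d u) odd) ⟩
    p u * (∑ n odd * (4 * d u))                       ≡⟨ cong (λ k → p u * (k * (4 * d u))) (∑-odd h) ⟩
    p u * (h * (4 * d u))                             ≡⟨ lemma₃ (p u) h (d u) ⟩
    h * 4 * (p u * d u)                               ∎

∑³-weighted-even : ∀ {A} B {C} → Odd A → Odd C → ∀ j →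
  ∑³ (2 ^ (3 + j)) (weighted even (2 ^ (3 + j)) A B C) ≡
  2 ^ (2 + j) * 4 * (2 ^ (1 + j) * [ + 4 ∣ B ℤ.+ C ])
∑³-weighted-even {A} B {C} oA oC j = trans (∑³-weighted even A B oC j)
  (cong (2 ^ (2 + j) * 4 *_) (∑-even-square oA (B ℤ.+ C) (2 ^ (1 + j))))

∑³-weighted-all : ∀ {A} B {C} → + 8 ∣ A → Odd C → ∀ j →
  ∑³ (2 ^ (3 + j)) (weighted (const 1) (2 ^ (3 + j)) A B C) ≡
  2 ^ (2 + j) * 4 * (2 ^ (3 + j) * [ + 8 ∣ B ℤ.+ C ])
∑³-weighted-all {A} B {C} 8∣A oC j = trans (∑³-weighted (const 1) A B oC j)
  (cong (2 ^ (2 + j) * 4 *_) (trans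
    (∑-cong n λ u → trans (ℕ.*-identityˡ [ + 8 ∣ A ℤ.* sq u ℤ.+ (B ℤ.+ C) ])
      ([∣]-cong (+ 8) (A ℤ.* sq u ℤ.+ (B ℤ.+ C)) (B ℤ.+ C)
        (∣-resp (sym (lemma (A ℤ.* sq u) (B ℤ.+ C))) (∣m⇒∣m*n (sq u) 8∣A))))
    (∑-const n [ + 8 ∣ B ℤ.+ C ])))
  where
  n : ℕ
  n = 2 ^ (3 + j)
  lemma : ∀ a e → a ℤ.+ e ℤ.- e ≡ a
  lemma = solve-∀

cube : ℕ → ℤ
cube n = + (n ^ 3)

cube≡ : ∀ n → cube n ≡ + n ℤ.* (+ n ℤ.* + n)
cube≡ n = begin
  + (n * (n * (n * 1)))     ≡⟨ cong (λ k → + (n * (n * k))) (ℕ.*-identityʳ n) ⟩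
  + (n * (n * n))           ≡⟨ ℤ.pos-* n (n * n) ⟩
  + n ℤ.* + (n * n)         ≡⟨ cong (+ n ℤ.*_) (ℤ.pos-* n n) ⟩
  + n ℤ.* (+ n ℤ.* + n)     ∎

odd-cube : ∀ {n} → Odd (+ n) → Odd (cube n)
odd-cube {n} o = subst Odd (sym (cube≡ n)) (odd*odd o (odd*odd o o))

odd-cube-mod8 : ∀ n → Odd (+ n) → + 8 ∣ cube n ℤ.- + n
odd-cube-mod8 n o = ∣-resp (trans (lemma (+ n)) (cong (ℤ._- + n) (sym (cube≡ n)))) (∣n⇒∣m*n (+ n) (odd-sq o))
  where
  lemma : ∀ i → i ℤ.* (i ℤ.* i ℤ.- + 1) ≡ i ℤ.* (i ℤ.* i) ℤ.- i
  lemma = solve-∀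

even-cube : ∀ {n} → Even (+ n) → + 8 ∣ cube n
even-cube {n} (divides q eq) = divides (q ℤ.* (q ℤ.* q))
  (trans (cube≡ n) (trans (cong (λ i → i ℤ.* (i ℤ.* i)) eq) (lemma q)))
  where
  lemma : ∀ q → q ℤ.* + 2 ℤ.* (q ℤ.* + 2 ℤ.* (q ℤ.* + 2)) ≡ q ℤ.* (q ℤ.* q) ℤ.* + 8
  lemma = solve-∀

odd⇒∤ : ∀ {n} → Odd (+ n) → ¬ 2 ℕ.∣ n
odd⇒∤ o = o ∘ ∣ᵤ⇒∣

∤⇒odd : ∀ {n} → ¬ 2 ℕ.∣ n → Odd (+ n)
∤⇒odd ∤n = ∤n ∘ ∣⇒∣ᵤ

odd-product : ∀ {m n} → Odd (+ m) → Odd (+ n) → ¬ 2 ℕ.∣ m * n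
odd-product {m} {n} om on = [ odd⇒∤ om , odd⇒∤ on ]′ ∘ euclidsLemma m n prime[2]

odd-factorˡ : ∀ {m} n → ¬ 2 ℕ.∣ m * n → Odd (+ m)
odd-factorˡ n ∤mn = ∤⇒odd (∤mn ∘ ℕ.∣m⇒∣m*n n)

odd-factorʳ : ∀ m {n} → ¬ 2 ℕ.∣ m * n → Odd (+ n)
odd-factorʳ m ∤mn = ∤⇒odd (∤mn ∘ ℕ.∣n⇒∣m*n m)

odd-term : ∀ {A} x → Odd A → Odd (+ x) → Odd (A ℤ.* sq x)
odd-term x oA ox = odd*odd oA (odd*odd ox ox)

even-term : ∀ A x → Even (+ x) → Even (A ℤ.* sq x)
even-term A x ex = ∣n⇒∣m*n A (∣m⇒∣m*n (+ x) ex)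

same-parity : ∀ {A B C} u v s → Even A → Odd B → Odd C → Even (Form A B C u v s) →
  Odd (+ v) ⊎ Odd (+ s) → Odd (+ v) × Odd (+ s)
same-parity {A} {B} {C} u v s eA oB oC eF one = v-odd one , s-odd one
  where
  eu : Even (A ℤ.* sq u)
  eu = ∣m⇒∣m*n (sq u) eA
  v-odd : Odd (+ v) ⊎ Odd (+ s) → Odd (+ v)
  v-odd (inj₁ ov) = ov
  v-odd (inj₂ os) ev = even+odd (∣m∣n⇒∣m+n eu (even-term B v ev)) (odd-term s oC os) eF
  s-odd : Odd (+ v) ⊎ Odd (+ s) → Odd (+ s)
  s-odd (inj₂ os) = os
  s-odd (inj₁ ov) es = odd+even (even+odd eu (odd-term v oB ov)) (even-term C s es) eF

𝟙-odd-odd : ∀ v s (p : Dec P) →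
  𝟙 (¬? (even? (+ v)) ×-dec ¬? (even? (+ s)) ×-dec p) ≡ odd v * (odd s * 𝟙 p)
𝟙-odd-odd v s p = trans (𝟙-× (¬? (even? (+ v))) (¬? (even? (+ s)) ×-dec p))
  (cong (odd v *_) (𝟙-× (¬? (even? (+ s))) p))

weighted-even : ∀ n A B C u v s →
  𝟙 (even? (+ u) ×-dec ¬? (even? (+ v)) ×-dec ¬? (even? (+ s)) ×-dec (+ n ∣? Form A B C u v s)) ≡
  weighted even n A B C u v s
weighted-even n A B C u v s =
  trans (𝟙-× (even? (+ u)) (¬? (even? (+ v)) ×-dec ¬? (even? (+ s)) ×-dec d))
        (cong (even u *_) (𝟙-odd-odd v s d))
  where
  d : Dec (+ n ∣ Form A B C u v s)
  d = + n ∣? Form A B C u v s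

weighted-all : ∀ n A B C u v s →
  𝟙 (¬? (even? (+ v)) ×-dec ¬? (even? (+ s)) ×-dec (+ n ∣? Form A B C u v s)) ≡
  weighted (const 1) n A B C u v s
weighted-all n A B C u v s = trans (𝟙-odd-odd v s (+ n ∣? Form A B C u v s))
  (sym (ℕ.*-identityˡ (odd v * (odd s * [ + n ∣ Form A B C u v s ]))))

module _ (y₀ y₁ y₂ : ℕ) (j : ℕ) where

  private
    r n : ℕ
    r = 3 + j
    n = 2 ^ r
    y : Triple ℕ
    y = y₀ , y₁ , y₂
    A B C : ℤ
    A = cube y₀
    B = cube y₁
    C = ℤ.- cube y₂

  even-of-multiple : ∀ {z} → + n ∣ z → Even z
  even-of-multiple = ∣-trans (divides (+ (2 ^ (2 + j))) (trans (ℤ.pos-* 2 (2 ^ (2 + j))) (ℤ.*-comm (+ 2) (+ (2 ^ (2 + j))))))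

  difference≡Form : ∀ x₀ x₁ x₂ →
    + (y₀ ^ 3 * x₀ ^ 2 + y₁ ^ 3 * x₁ ^ 2) ℤ.- + (y₂ ^ 3 * x₂ ^ 2) ≡ Form A B C x₀ x₁ x₂
  difference≡Form x₀ x₁ x₂ = begin
    + (y₀ ^ 3 * x₀ ^ 2 + y₁ ^ 3 * x₁ ^ 2) ℤ.- + (y₂ ^ 3 * x₂ ^ 2)
      ≡⟨ cong (ℤ._- + (y₂ ^ 3 * x₂ ^ 2)) (ℤ.pos-+ (y₀ ^ 3 * x₀ ^ 2) (y₁ ^ 3 * x₁ ^ 2)) ⟩
    + (y₀ ^ 3 * x₀ ^ 2) ℤ.+ + (y₁ ^ 3 * x₁ ^ 2) ℤ.- + (y₂ ^ 3 * x₂ ^ 2)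
      ≡⟨ cong₂ ℤ._-_ (cong₂ ℤ._+_ (term (y₀ ^ 3) x₀) (term (y₁ ^ 3) x₁)) (term (y₂ ^ 3) x₂) ⟩
    A ℤ.* sq x₀ ℤ.+ B ℤ.* sq x₁ ℤ.- cube y₂ ℤ.* sq x₂
      ≡⟨ cong (λ c → A ℤ.* sq x₀ ℤ.+ B ℤ.* sq x₁ ℤ.+ c) (ℤ.neg-distribˡ-* (cube y₂) (sq x₂)) ⟩
    Form A B C x₀ x₁ x₂ ∎
    where
    term : ∀ a x → + (a * x ^ 2) ≡ + a ℤ.* sq x
    term a x = begin
      + (a * (x * (x * 1)))   ≡⟨ cong (λ k → + (a * (x * k))) (ℕ.*-identityʳ x) ⟩
      + (a * (x * x))         ≡⟨ ℤ.pos-* a (x * x) ⟩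
      + a ℤ.* + (x * x)       ≡⟨ cong (+ a ℤ.*_) (ℤ.pos-* x x) ⟩
      + a ℤ.* sq x            ∎

  Sol : ℕ → ℕ → ℕ → Set
  Sol x₀ x₁ x₂ = + n ∣ Form A B C x₀ x₁ x₂

  solves⇒ : ∀ {i j k} → Solves y r (i , j , k) → Sol (toℕ i) (toℕ j) (toℕ k)
  solves⇒ {i} {j} {k} = ∣-resp (difference≡Form (toℕ i) (toℕ j) (toℕ k)) ∘ ∣ᵤ⇒∣

  solves⇐ : ∀ {i j k} → Sol (toℕ i) (toℕ j) (toℕ k) → Solves y r (i , j , k)
  solves⇐ {i} {j} {k} = ∣⇒∣ᵤ ∘ ∣-resp (sym (difference≡Form (toℕ i) (toℕ j) (toℕ k)))

  module _ (o₀ : Odd (+ y₀)) (o₁ : Odd (+ y₁)) (o₂ : Odd (+ y₂)) where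

    private
      oA : Odd A
      oA = odd-cube o₀
      oB : Odd B
      oB = odd-cube o₁
      oC : Odd C
      oC = odd-neg (odd-cube o₂)

      E₀ E₁ E₂ : ℕ → ℕ → ℕ → Set
      E₀ u v s = Even (+ u) × Odd (+ v) × Odd (+ s) × + n ∣ Form A B C u v s
      E₁ u v s = Even (+ v) × Odd (+ u) × Odd (+ s) × + n ∣ Form B A C v u s
      E₂ u v s = Even (+ s) × Odd (+ u) × Odd (+ v) × + n ∣ Form C A B s u v

    one-even : ∀ u v s → ¬ (Even (+ u) × Even (+ v) × Even (+ s)) → Sol u v s →
      E₀ u v s ⊎ E₁ u v s ⊎ E₂ u v s
    one-even u v s not-all d with even? (+ u) | even? (+ v) | even? (+ s)
    ... | yes a | yes b | yes c = contradiction (a , b , c) not-all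
    ... | yes a | yes b | no  c = contradiction (even-of-multiple d)
      (even+odd (∣m∣n⇒∣m+n (even-term A u a) (even-term B v b)) (odd-term s oC c))
    ... | yes a | no  b | yes c = contradiction (even-of-multiple d)
      (odd+even (even+odd (even-term A u a) (odd-term v oB b)) (even-term C s c))
    ... | no  a | yes b | yes c = contradiction (even-of-multiple d)
      (odd+even (odd+even (odd-term u oA a) (even-term B v b)) (even-term C s c))
    ... | no  a | no  b | no  c = contradiction (even-of-multiple d)
      (even+odd (odd+odd (odd-term u oA a) (odd-term v oB b)) (odd-term s oC c))
    ... | yes a | no  b | no  c = inj₁ (a , b , c , d)
    ... | no  a | yes b | no  c = inj₂ (inj₁ (b , a , c , ∣-resp (Form-swap₀₁ A B C u v s) d))
    ... | no  a | no  b | yes c = inj₂ (inj₂ (c , a , b , ∣-resp (Form-rotate A B C u v s) d))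

    counted-odd : ∀ i j k → let u = toℕ i; v = toℕ j; s = toℕ k in
      𝟙 (counted? y r (i , j , k)) ≡
      weighted even n A B C u v s + (weighted even n B A C v u s + weighted even n C A B s u v)
    counted-odd i j k = begin
      𝟙 (counted? y r (i , j , k))
        ≡⟨ 𝟙-cong (counted? y r (i , j , k)) (e₀ ⊎-dec e₁ ⊎-dec e₂) to [ from₀ , [ from₁ , from₂ ]′ ]′ ⟩
      𝟙 (e₀ ⊎-dec e₁ ⊎-dec e₂)
        ≡⟨ 𝟙-⊎ e₀ (e₁ ⊎-dec e₂) (λ { ((a , _) , inj₁ (_ , ¬a , _)) → ¬a a ; ((a , _) , inj₂ (_ , ¬a , _)) → ¬a a }) ⟩
      𝟙 e₀ + 𝟙 (e₁ ⊎-dec e₂)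
        ≡⟨ cong (_+_ (𝟙 e₀)) (𝟙-⊎ e₁ e₂ λ { ((b , _) , (_ , _ , ¬b , _)) → ¬b b }) ⟩
      𝟙 e₀ + (𝟙 e₁ + 𝟙 e₂)
        ≡⟨ cong₂ _+_ (weighted-even n A B C u v s)
             (cong₂ _+_ (weighted-even n B A C v u s) (weighted-even n C A B s u v)) ⟩
      _ ∎
      where
      u v s : ℕ
      u = toℕ i
      v = toℕ j
      s = toℕ k
      e₀ : Dec (E₀ u v s)
      e₀ = even? (+ u) ×-dec ¬? (even? (+ v)) ×-dec ¬? (even? (+ s)) ×-dec (+ n ∣? Form A B C u v s)
      e₁ : Dec (E₁ u v s)
      e₁ = even? (+ v) ×-dec ¬? (even? (+ u)) ×-dec ¬? (even? (+ s)) ×-dec (+ n ∣? Form B A C v u s)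
      e₂ : Dec (E₂ u v s)
      e₂ = even? (+ s) ×-dec ¬? (even? (+ u)) ×-dec ¬? (even? (+ v)) ×-dec (+ n ∣? Form C A B s u v)
      to : Counted y r (i , j , k) → E₀ u v s ⊎ E₁ u v s ⊎ E₂ u v s
      to (not-all , d , _) = one-even u v s
        (λ (a , b , c) → not-all (∣⇒∣ᵤ a , ∣⇒∣ᵤ b , ∣⇒∣ᵤ c)) (solves⇒ {i} {j} {k} d)
      from₀ : E₀ u v s → Counted y r (i , j , k)
      from₀ (_ , ov , _ , d) = (λ (_ , b , _) → odd⇒∤ ov b) , solves⇐ {i} {j} {k} d , inj₂ (inj₁ (odd-product ov o₁))
      from₁ : E₁ u v s → Counted y r (i , j , k)
      from₁ (_ , ou , _ , d) = (λ (a , _) → odd⇒∤ ou a) ,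
        solves⇐ {i} {j} {k} (∣-resp (Form-swap₀₁ B A C v u s) d) , inj₁ (odd-product ou o₀)
      from₂ : E₂ u v s → Counted y r (i , j , k)
      from₂ (_ , ou , _ , d) = (λ (a , _) → odd⇒∤ ou a) ,
        solves⇐ {i} {j} {k} (∣-resp (sym (Form-rotate A B C u v s)) d) , inj₁ (odd-product ou o₀)

    N*-odd : N* y r ≡ 2 ^ (2 + j) * 4 * (2 ^ (1 + j) *
      ([ + 4 ∣ B ℤ.+ C ] + ([ + 4 ∣ A ℤ.+ C ] + [ + 4 ∣ A ℤ.+ B ])))
    N*-odd = begin
      N* y r
        ≡⟨ N*≡∑ y r (λ u v s → f₀ u v s + (f₁ v u s + f₂ s u v)) counted-odd ⟩
      ∑³ n (λ u v s → f₀ u v s + (f₁ v u s + f₂ s u v))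
        ≡⟨ ∑³-distrib n f₀ (λ u v s → f₁ v u s + f₂ s u v) ⟩
      ∑³ n f₀ + ∑³ n (λ u v s → f₁ v u s + f₂ s u v)
        ≡⟨ cong (_+_ (∑³ n f₀)) (∑³-distrib n (λ u v s → f₁ v u s) (λ u v s → f₂ s u v)) ⟩
      ∑³ n f₀ + (∑³ n (λ u v s → f₁ v u s) + ∑³ n (λ u v s → f₂ s u v))
        ≡⟨ cong₂ _+_ (∑³-weighted-even B oA oC j) (cong₂ _+_
             (trans (∑³-swap₀₁ n f₁) (∑³-weighted-even A oB oC j))
             (trans (∑³-rotate n f₂) (∑³-weighted-even A oC oB j))) ⟩
      K * (h * d₀) + (K * (h * d₁) + K * (h * d₂))
        ≡⟨ lemma K h d₀ d₁ d₂ ⟩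
      K * (h * (d₀ + (d₁ + d₂))) ∎
      where
      f₀ f₁ f₂ : ℕ → ℕ → ℕ → ℕ
      f₀ = weighted even n A B C
      f₁ = weighted even n B A C
      f₂ = weighted even n C A B
      K h d₀ d₁ d₂ : ℕ
      K = 2 ^ (2 + j) * 4
      h = 2 ^ (1 + j)
      d₀ = [ + 4 ∣ B ℤ.+ C ]
      d₁ = [ + 4 ∣ A ℤ.+ C ]
      d₂ = [ + 4 ∣ A ℤ.+ B ]
      lemma : ∀ K h a b c → K * (h * a) + (K * (h * b) + K * (h * c)) ≡ K * (h * (a + (b + c)))
      lemma = ℕ.solve-∀

  private
    indicator-even : ∀ {P : Set} (p : Dec P) {A B C} u v s → Even A → Odd B → Odd C →
      (P → Odd (+ v) ⊎ Odd (+ s)) → (P → + n ∣ Form A B C u v s) →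
      (Odd (+ v) → + n ∣ Form A B C u v s → P) →
      𝟙 p ≡ weighted (const 1) n A B C u v s
    indicator-even p {A} {B} {C} u v s eA oB oC one sol counted = trans
      (𝟙-cong p (¬? (even? (+ v)) ×-dec ¬? (even? (+ s)) ×-dec (+ n ∣? Form A B C u v s))
        (λ c → let ov , os = same-parity u v s eA oB oC (even-of-multiple (sol c)) (one c) in ov , os , sol c)
        (λ (ov , _ , d) → counted ov d))
      (weighted-all n A B C u v s)

    even-of-8∣ : ∀ {z} → + 8 ∣ z → Even z
    even-of-8∣ = ∣-trans (divides (+ 4) refl)

  N*-even₀ : Even (+ y₀) → Odd (+ y₁) → Odd (+ y₂) →
    N* y r ≡ 2 ^ (2 + j) * 4 * (2 ^ (3 + j) * [ + 8 ∣ B ℤ.+ C ])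
  N*-even₀ e₀ o₁ o₂ = trans
    (N*≡∑ y r (weighted (const 1) n A B C) λ i j k →
      indicator-even (counted? y r (i , j , k)) (toℕ i) (toℕ j) (toℕ k) (even-of-8∣ 8∣A) (odd-cube o₁) oC
        (λ (_ , _ , p) → [ (λ ∤ → contradiction e₀ (odd-factorʳ (toℕ i) ∤))
                         , [ inj₁ ∘ odd-factorˡ y₁ , inj₂ ∘ odd-factorˡ y₂ ]′ ]′ p)
        (λ (_ , d , _) → solves⇒ {i} {j} {k} d)
        (λ ov d → (λ (_ , b , _) → odd⇒∤ ov b) , solves⇐ {i} {j} {k} d , inj₂ (inj₁ (odd-product ov o₁))))
    (∑³-weighted-all B 8∣A oC j)
    where
    8∣A : + 8 ∣ A
    8∣A = even-cube e₀
    oC : Odd C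
    oC = odd-neg (odd-cube o₂)

  N*-even₁ : Odd (+ y₀) → Even (+ y₁) → Odd (+ y₂) →
    N* y r ≡ 2 ^ (2 + j) * 4 * (2 ^ (3 + j) * [ + 8 ∣ A ℤ.+ C ])
  N*-even₁ o₀ e₁ o₂ = trans
    (N*≡∑ y r (λ u v s → weighted (const 1) n B A C v u s) λ i j k →
      indicator-even (counted? y r (i , j , k)) (toℕ j) (toℕ i) (toℕ k) (even-of-8∣ 8∣B) (odd-cube o₀) oC
        (λ (_ , _ , p) → [ inj₁ ∘ odd-factorˡ y₀
                         , [ (λ ∤ → contradiction e₁ (odd-factorʳ (toℕ j) ∤)) , inj₂ ∘ odd-factorˡ y₂ ]′ ]′ p)
        (λ (_ , d , _) → ∣-resp (Form-swap₀₁ A B C (toℕ i) (toℕ j) (toℕ k)) (solves⇒ {i} {j} {k} d))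
        (λ ou d → (λ (a , _) → odd⇒∤ ou a) ,
          solves⇐ {i} {j} {k} (∣-resp (Form-swap₀₁ B A C (toℕ j) (toℕ i) (toℕ k)) d) , inj₁ (odd-product ou o₀)))
    (trans (∑³-swap₀₁ n (weighted (const 1) n B A C)) (∑³-weighted-all A 8∣B oC j))
    where
    8∣B : + 8 ∣ B
    8∣B = even-cube e₁
    oC : Odd C
    oC = odd-neg (odd-cube o₂)

  N*-even₂ : Odd (+ y₀) → Odd (+ y₁) → Even (+ y₂) →
    N* y r ≡ 2 ^ (2 + j) * 4 * (2 ^ (3 + j) * [ + 8 ∣ A ℤ.+ B ])
  N*-even₂ o₀ o₁ e₂ = trans
    (N*≡∑ y r (λ u v s → weighted (const 1) n C A B s u v) λ i j k →
      indicator-even (counted? y r (i , j , k)) (toℕ k) (toℕ i) (toℕ j) (even-of-8∣ 8∣C) (odd-cube o₀) (odd-cube o₁)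
        (λ (_ , _ , p) → [ inj₁ ∘ odd-factorˡ y₀
                         , [ inj₂ ∘ odd-factorˡ y₁ , (λ ∤ → contradiction e₂ (odd-factorʳ (toℕ k) ∤)) ]′ ]′ p)
        (λ (_ , d , _) → ∣-resp (Form-rotate A B C (toℕ i) (toℕ j) (toℕ k)) (solves⇒ {i} {j} {k} d))
        (λ ou d → (λ (a , _) → odd⇒∤ ou a) ,
          solves⇐ {i} {j} {k} (∣-resp (sym (Form-rotate A B C (toℕ i) (toℕ j) (toℕ k))) d) , inj₁ (odd-product ou o₀)))
    (trans (∑³-rotate n (weighted (const 1) n C A B)) (∑³-weighted-all A 8∣C (odd-cube o₁) j))
    where
    8∣C : + 8 ∣ C
    8∣C = ∣m⇒∣-m (even-cube e₂)

N*/2^2r≡ : ∀ y r c → N* y r ≡ c * 2 ^ (2 * r) → N*/2^2r y r ≡ + c / 1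
N*/2^2r≡ y r c eq = ratio (2 ^ (2 * r)) {{ℕ.m^n≢0 2 (2 * r)}} eq
  where
  ratio : ∀ {k} m .{{_ : ℕ.NonZero m}} → k ≡ c * m → + k / m ≡ + c / 1
  ratio (suc m) refl = fromℚᵘ-cong {mkℚᵘ (+ (c * suc m)) m} {mkℚᵘ (+ c) 0}
    (*≡* (trans (ℤ.*-identityʳ (+ (c * suc m))) (ℤ.pos-* c (suc m))))

2^2r : ∀ j → 2 ^ (2 * (3 + j)) ≡ 2 ^ (3 + j) * 2 ^ (3 + j)
2^2r j = trans (cong (λ k → 2 ^ (3 + j + k)) (ℕ.+-identityʳ (3 + j))) (ℕ.^-distribˡ-+-* 2 (3 + j) (3 + j))

odd-total : ∀ j c → 2 ^ (2 + j) * 4 * (2 ^ (1 + j) * (2 * c)) ≡ c * 2 ^ (2 * (3 + j))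
odd-total j c = trans (lemma (2 ^ j) c) (cong (c *_) (sym (2^2r j)))
  where
  lemma : ∀ n c → 2 * (2 * n) * 4 * (2 * n * (2 * c)) ≡ c * (2 * (2 * (2 * n)) * (2 * (2 * (2 * n))))
  lemma = ℕ.solve-∀

even-total : ∀ j d → 2 ^ (2 + j) * 4 * (2 ^ (3 + j) * d) ≡ 2 * d * 2 ^ (2 * (3 + j))
even-total j d = trans (lemma (2 ^ j) d) (cong (2 * d *_) (sym (2^2r j)))
  where
  lemma : ∀ n d → 2 * (2 * n) * 4 * (2 * (2 * (2 * n)) * d) ≡ 2 * d * (2 * (2 * (2 * n)) * (2 * (2 * (2 * n))))
  lemma = ℕ.solve-∀

[∣]-cong-+ : ∀ m a b c d → m ∣ a ℤ.- b → m ∣ c ℤ.- d → [ m ∣ a ℤ.+ c ] ≡ [ m ∣ b ℤ.+ d ]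
[∣]-cong-+ m a b c d p q =
  [∣]-cong m (a ℤ.+ c) (b ℤ.+ d) (∣-resp (lemma a b c d) (∣m∣n⇒∣m+n p q))
  where
  lemma : ∀ a b c d → a ℤ.- b ℤ.+ (c ℤ.- d) ≡ a ℤ.+ c ℤ.- (b ℤ.+ d)
  lemma = solve-∀

odd-neg-cube-mod8 : ∀ n → Odd (+ n) → + 8 ∣ ℤ.- cube n ℤ.- ℤ.- + n
odd-neg-cube-mod8 n o = ∣-resp (lemma (cube n) (+ n)) (∣m⇒∣-m (odd-cube-mod8 n o))
  where
  lemma : ∀ a b → ℤ.- (a ℤ.- b) ≡ ℤ.- a ℤ.- ℤ.- b
  lemma = solve-∀

module _ {p q : ℤ} (op : Odd p) (oq : Odd q) where

  [4∣±] : [ + 4 ∣ p ℤ.+ q ] + [ + 4 ∣ p ℤ.- q ] ≡ 1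
  [4∣±] = begin
    [ + 4 ∣ p ℤ.+ q ] + [ + 4 ∣ p ℤ.- q ]
      ≡⟨ cong (λ z → [ + 4 ∣ p ℤ.+ q ] + [ + 4 ∣ z ]) (lemma p q) ⟩
    [ + 4 ∣ p ℤ.+ q ] + [ + 4 ∣ p ℤ.+ q ℤ.+ + 2 ℤ.* (ℤ.- q) ]
      ≡⟨ lift-unique (+ 2) (p ℤ.+ q) (odd-neg oq) ⟩
    [ + 2 ∣ p ℤ.+ q ]
      ≡⟨ 𝟙-yes (+ 2 ∣? p ℤ.+ q) (odd+odd op oq) ⟩
    1 ∎
    where
    lemma : ∀ p q → p ℤ.- q ≡ p ℤ.+ q ℤ.+ + 2 ℤ.* (ℤ.- q)
    lemma = solve-∀

  4∤+ : + 4 ∣ p ℤ.- q → ¬ + 4 ∣ p ℤ.+ q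
  4∤+ d e = contradiction
    (trans (sym (cong₂ _+_ (𝟙-yes (+ 4 ∣? p ℤ.+ q) e) (𝟙-yes (+ 4 ∣? p ℤ.- q) d))) [4∣±]) λ ()

  4∣+ : ¬ + 4 ∣ p ℤ.- q → + 4 ∣ p ℤ.+ q
  4∣+ ∤d = decidable-stable (+ 4 ∣? p ℤ.+ q) λ ∤e → contradiction
    (trans (sym (cong₂ _+_ (𝟙-no (+ 4 ∣? p ℤ.+ q) ∤e) (𝟙-no (+ 4 ∣? p ℤ.- q) ∤d))) [4∣±]) λ ()

  4∣- : ¬ + 4 ∣ p ℤ.+ q → + 4 ∣ p ℤ.- q
  4∣- ∤e = decidable-stable (+ 4 ∣? p ℤ.- q) (∤e ∘ 4∣+)

module _ {p q s : ℤ} (op : Odd p) (oq : Odd q) (os : Odd s) where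

  private
    total : ℕ
    total = [ + 4 ∣ q ℤ.- s ] + ([ + 4 ∣ p ℤ.- s ] + [ + 4 ∣ p ℤ.+ q ])

    total≡ : ∀ {a b c} → [ + 4 ∣ q ℤ.- s ] ≡ a → [ + 4 ∣ p ℤ.- s ] ≡ b → [ + 4 ∣ p ℤ.+ q ] ≡ c →
      total ≡ a + (b + c)
    total≡ x y z = cong₂ _+_ x (cong₂ _+_ y z)

    p-s : p ℤ.- q ℤ.+ (q ℤ.- s) ≡ p ℤ.- s
    p-s = lemma p q s
      where
      lemma : ∀ p q s → p ℤ.- q ℤ.+ (q ℤ.- s) ≡ p ℤ.- s
      lemma = solve-∀

    p+q : p ℤ.- s ℤ.+ (q ℤ.+ s) ≡ p ℤ.+ q
    p+q = lemma p q s
      where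
      lemma : ∀ p q s → p ℤ.- s ℤ.+ (q ℤ.+ s) ≡ p ℤ.+ q
      lemma = solve-∀

  total-exceptional : + 4 ∣ p ℤ.- q → + 4 ∣ q ℤ.+ s → total ≡ 0
  total-exceptional d e = total≡
    (𝟙-no (+ 4 ∣? q ℤ.- s) ∤q-s)
    (𝟙-no (+ 4 ∣? p ℤ.- s) λ f → ∤q-s (∣m+n∣m⇒∣n (∣-resp (sym p-s) f) d))
    (𝟙-no (+ 4 ∣? p ℤ.+ q) (4∤+ op oq d))
    where
    ∤q-s : ¬ + 4 ∣ q ℤ.- s
    ∤q-s f = 4∤+ oq os f e

  total-generic : ¬ (+ 4 ∣ p ℤ.- q × + 4 ∣ q ℤ.+ s) → total ≡ 2
  total-generic not-both with + 4 ∣? p ℤ.- q | + 4 ∣? q ℤ.+ s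
  ... | yes d | yes e = contradiction (d , e) not-both
  ... | yes d | no ∤e = total≡
    (𝟙-yes (+ 4 ∣? q ℤ.- s) (4∣- oq os ∤e))
    (𝟙-yes (+ 4 ∣? p ℤ.- s) (∣-resp p-s (∣m∣n⇒∣m+n d (4∣- oq os ∤e))))
    (𝟙-no (+ 4 ∣? p ℤ.+ q) (4∤+ op oq d))
  ... | no ∤d | yes e = total≡
    (𝟙-no (+ 4 ∣? q ℤ.- s) (λ f → 4∤+ oq os f e))
    (𝟙-yes (+ 4 ∣? p ℤ.- s) (∣m+n∣n⇒∣m (∣-resp (sym p+q) (4∣+ op oq ∤d)) e))
    (𝟙-yes (+ 4 ∣? p ℤ.+ q) (4∣+ op oq ∤d))
  ... | no ∤d | no ∤e = total≡
    (𝟙-yes (+ 4 ∣? q ℤ.- s) (4∣- oq os ∤e))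
    (𝟙-no (+ 4 ∣? p ℤ.- s) (λ f → ∤d (∣m+n∣n⇒∣m (∣-resp (sym p-s) f) (4∣- oq os ∤e))))
    (𝟙-yes (+ 4 ∣? p ℤ.+ q) (4∣+ op oq ∤d))

square∤squareFree : ∀ {n} → SquareFree n → ¬ 2 * 2 ℕ.∣ n
square∤squareFree sf d with sf 2 d
... | ()

module _ (y₀ y₁ y₂ : ℕ) (sf : SquareFree (y₀ * y₁ * y₂)) where

  private
    coprime₀₁ : ¬ (2 ℕ.∣ y₀ × 2 ℕ.∣ y₁)
    coprime₀₁ (a , b) = square∤squareFree sf (ℕ.∣m⇒∣m*n y₂ (ℕ.*-pres-∣ a b))

    coprime₀₂ : ¬ (2 ℕ.∣ y₀ × 2 ℕ.∣ y₂)
    coprime₀₂ (a , c) = square∤squareFree sf (ℕ.*-pres-∣ (ℕ.∣m⇒∣m*n y₁ a) c)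

    coprime₁₂ : ¬ (2 ℕ.∣ y₁ × 2 ℕ.∣ y₂)
    coprime₁₂ (b , c) = square∤squareFree sf (ℕ.*-pres-∣ (ℕ.∣n⇒∣m*n y₀ b) c)

  module _ (j : ℕ) where

    private
      y : Triple ℕ
      y = y₀ , y₁ , y₂
      r : ℕ
      r = 3 + j

    value-even₀ : 2 ℕ.∣ y₀ → N*/2^2r y r ≡ + (2 * [ + 8 ∣ + y₁ ℤ.- + y₂ ]) / 1
    value-even₀ e₀ = N*/2^2r≡ y r (2 * [ + 8 ∣ + y₁ ℤ.- + y₂ ]) (trans (N*-even₀ y₀ y₁ y₂ j (∣ᵤ⇒∣ e₀) o₁ o₂) (trans
      (cong (λ d → 2 ^ (2 + j) * 4 * (2 ^ (3 + j) * d))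
        ([∣]-cong-+ (+ 8) (cube y₁) (+ y₁) (ℤ.- cube y₂) (ℤ.- + y₂) (odd-cube-mod8 y₁ o₁) (odd-neg-cube-mod8 y₂ o₂)))
      (even-total j [ + 8 ∣ + y₁ ℤ.- + y₂ ])))
      where
      o₁ : Odd (+ y₁)
      o₁ = ∤⇒odd (λ e₁ → coprime₀₁ (e₀ , e₁))
      o₂ : Odd (+ y₂)
      o₂ = ∤⇒odd (λ e₂ → coprime₀₂ (e₀ , e₂))

    value-even₁ : 2 ℕ.∣ y₁ → N*/2^2r y r ≡ + (2 * [ + 8 ∣ + y₀ ℤ.- + y₂ ]) / 1
    value-even₁ e₁ = N*/2^2r≡ y r (2 * [ + 8 ∣ + y₀ ℤ.- + y₂ ]) (trans (N*-even₁ y₀ y₁ y₂ j o₀ (∣ᵤ⇒∣ e₁) o₂) (trans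
      (cong (λ d → 2 ^ (2 + j) * 4 * (2 ^ (3 + j) * d))
        ([∣]-cong-+ (+ 8) (cube y₀) (+ y₀) (ℤ.- cube y₂) (ℤ.- + y₂) (odd-cube-mod8 y₀ o₀) (odd-neg-cube-mod8 y₂ o₂)))
      (even-total j [ + 8 ∣ + y₀ ℤ.- + y₂ ])))
      where
      o₀ : Odd (+ y₀)
      o₀ = ∤⇒odd (λ e₀ → coprime₀₁ (e₀ , e₁))
      o₂ : Odd (+ y₂)
      o₂ = ∤⇒odd (λ e₂ → coprime₁₂ (e₁ , e₂))

    value-even₂ : 2 ℕ.∣ y₂ → N*/2^2r y r ≡ + (2 * [ + 8 ∣ + y₀ ℤ.- (ℤ.- + y₁) ]) / 1
    value-even₂ e₂ = N*/2^2r≡ y r (2 * [ + 8 ∣ + y₀ ℤ.- (ℤ.- + y₁) ]) (trans (N*-even₂ y₀ y₁ y₂ j o₀ o₁ (∣ᵤ⇒∣ e₂)) (trans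
      (cong (λ d → 2 ^ (2 + j) * 4 * (2 ^ (3 + j) * d))
        (trans ([∣]-cong-+ (+ 8) (cube y₀) (+ y₀) (cube y₁) (+ y₁) (odd-cube-mod8 y₀ o₀) (odd-cube-mod8 y₁ o₁))
          (cong (λ z → [ + 8 ∣ + y₀ ℤ.+ z ]) (sym (ℤ.neg-involutive (+ y₁))))))
      (even-total j [ + 8 ∣ + y₀ ℤ.- (ℤ.- + y₁) ])))
      where
      o₀ : Odd (+ y₀)
      o₀ = ∤⇒odd (λ e₀ → coprime₀₂ (e₀ , e₂))
      o₁ : Odd (+ y₁)
      o₁ = ∤⇒odd (λ e₁ → coprime₁₂ (e₁ , e₂))

    value-odd : Odd (+ y₀) → Odd (+ y₁) → Odd (+ y₂) → ∀ c →
      [ + 4 ∣ + y₁ ℤ.- + y₂ ] + ([ + 4 ∣ + y₀ ℤ.- + y₂ ] + [ + 4 ∣ + y₀ ℤ.+ + y₁ ]) ≡ 2 * c →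
      N*/2^2r y r ≡ + c / 1
    value-odd o₀ o₁ o₂ c total≡2c = N*/2^2r≡ y r c (trans (N*-odd y₀ y₁ y₂ j o₀ o₁ o₂) (trans
      (cong (λ d → 2 ^ (2 + j) * 4 * (2 ^ (1 + j) * d)) (trans
        (cong₂ _+_ ([∣]-cong-+ (+ 4) (cube y₁) (+ y₁) (ℤ.- cube y₂) (ℤ.- + y₂) m₁ m₂)
          (cong₂ _+_ ([∣]-cong-+ (+ 4) (cube y₀) (+ y₀) (ℤ.- cube y₂) (ℤ.- + y₂) m₀ m₂)
                     ([∣]-cong-+ (+ 4) (cube y₀) (+ y₀) (cube y₁) (+ y₁) m₀ m₁)))
        total≡2c))
      (odd-total j c)))
      where
      4∣8 : ∀ {z} → + 8 ∣ z → + 4 ∣ z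
      4∣8 = ∣-trans (divides (+ 2) refl)
      m₀ : + 4 ∣ cube y₀ ℤ.- + y₀
      m₀ = 4∣8 (odd-cube-mod8 y₀ o₀)
      m₁ : + 4 ∣ cube y₁ ℤ.- + y₁
      m₁ = 4∣8 (odd-cube-mod8 y₁ o₁)
      m₂ : + 4 ∣ ℤ.- cube y₂ ℤ.- ℤ.- + y₂
      m₂ = 4∣8 (odd-neg-cube-mod8 y₂ o₂)

    private
      congruent : ∀ {a b} → a ≡ b [mod 8 ] → + (2 * [ + 8 ∣ a ℤ.- b ]) / 1 ≡ + 2 / 1
      congruent {a} {b} d = cong (λ k → + (2 * k) / 1) (𝟙-yes (+ 8 ∣? a ℤ.- b) (∣ᵤ⇒∣ d))

      incongruent : ∀ {a b} → ¬ a ≡ b [mod 8 ] → + (2 * [ + 8 ∣ a ℤ.- b ]) / 1 ≡ 0ℚ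
      incongruent {a} {b} ∤d = cong (λ k → + (2 * k) / 1) (𝟙-no (+ 8 ∣? a ℤ.- b) (∤d ∘ ∣⇒∣ᵤ))

      odd-parts : ¬ 2 ℕ.∣ y₀ * y₁ * y₂ → Odd (+ y₀) × Odd (+ y₁) × Odd (+ y₂)
      odd-parts ∤y = ∤⇒odd (∤y ∘ ℕ.∣m⇒∣m*n y₂ ∘ ℕ.∣m⇒∣m*n y₁)
        , ∤⇒odd (∤y ∘ ℕ.∣m⇒∣m*n y₂ ∘ ℕ.∣n⇒∣m*n y₀)
        , ∤⇒odd (∤y ∘ ℕ.∣n⇒∣m*n (y₀ * y₁))

      unneg : + y₁ ℤ.- (ℤ.- + y₂) ≡ + y₁ ℤ.+ + y₂
      unneg = cong (λ z → + y₁ ℤ.+ z) (ℤ.neg-involutive (+ y₂))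

    odd-case : OddCase y → N*/2^2r y r ≡ 1ℚ
    odd-case (∤y , generic) = let o₀ , o₁ , o₂ = odd-parts ∤y in
      value-odd o₀ o₁ o₂ 1 (total-generic o₀ o₁ o₂
        λ (d , e) → generic (∣⇒∣ᵤ d , ∣⇒∣ᵤ (∣-resp (sym unneg) e)))

    even-case₀ : EvenCase₀ y → N*/2^2r y r ≡ + 2 / 1
    even-case₀ (e , d) = trans (value-even₀ e) (congruent {+ y₁} {+ y₂} d)

    even-case₁ : EvenCase₁ y → N*/2^2r y r ≡ + 2 / 1
    even-case₁ (e , d) = trans (value-even₁ e) (congruent {+ y₀} {+ y₂} d)

    even-case₂ : EvenCase₂ y → N*/2^2r y r ≡ + 2 / 1
    even-case₂ (e , d) = trans (value-even₂ e) (congruent {+ y₀} {ℤ.- + y₁} d)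

    other-case : ¬ (OddCase y ⊎ EvenCase₀ y ⊎ EvenCase₁ y ⊎ EvenCase₂ y) → N*/2^2r y r ≡ 0ℚ
    other-case none = by-parity (2 ℕ.∣? y₀ * y₁ * y₂)
      where
      is-even₀ : 2 ℕ.∣ y₀ → N*/2^2r y r ≡ 0ℚ
      is-even₀ e = trans (value-even₀ e) (incongruent {+ y₁} {+ y₂} λ d → none (inj₂ (inj₁ (e , d))))

      is-even₁ : 2 ℕ.∣ y₁ → N*/2^2r y r ≡ 0ℚ
      is-even₁ e = trans (value-even₁ e) (incongruent {+ y₀} {+ y₂} λ d → none (inj₂ (inj₂ (inj₁ (e , d)))))

      is-even₂ : 2 ℕ.∣ y₂ → N*/2^2r y r ≡ 0ℚ
      is-even₂ e = trans (value-even₂ e) (incongruent {+ y₀} {ℤ.- + y₁} λ d → none (inj₂ (inj₂ (inj₂ (e , d)))))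

      by-parity : Dec (2 ℕ.∣ y₀ * y₁ * y₂) → N*/2^2r y r ≡ 0ℚ
      by-parity (yes ∣y) =
        [ [ is-even₀ , is-even₁ ]′ ∘ euclidsLemma y₀ y₁ prime[2] , is-even₂ ]′ (euclidsLemma (y₀ * y₁) y₂ prime[2] ∣y)
      by-parity (no ∤y) =
        let o₀ , o₁ , o₂ = odd-parts ∤y
            d , e = decidable-stable ((+ 4 ∣? + y₀ ℤ.- + y₁) ×-dec (+ 4 ∣? + y₁ ℤ.+ + y₂))
              λ generic → none (inj₁ (∤y , λ (d , e) → generic (∣ᵤ⇒∣ d , ∣-resp unneg (∣ᵤ⇒∣ e))))
        in value-odd o₀ o₁ o₂ 0 (total-exceptional o₀ o₁ o₂ d e)

lemma2 : (y₀ y₁ y₂ : ℕ) → 0 < y₀ → 0 < y₁ → 0 < y₂ → SquareFree (y₀ * y₁ * y₂) →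
    (r : ℕ) → 3 ≤ r →
    let y = (y₀ , y₁ , y₂) in
    (OddCase y → N*/2^2r y r ≡ 1ℚ) ×
    (EvenCase₀ y → N*/2^2r y r ≡ + 2 / 1) ×
    (EvenCase₁ y → N*/2^2r y r ≡ + 2 / 1) ×
    (EvenCase₂ y → N*/2^2r y r ≡ + 2 / 1) ×
    (¬ (OddCase y ⊎ EvenCase₀ y ⊎ EvenCase₁ y ⊎ EvenCase₂ y) → N*/2^2r y r ≡ 0ℚ)
lemma2 y₀ y₁ y₂ _ _ _ sf r 3≤r = at (ℕ.m≤n⇒∃[o]m+o≡n 3≤r)
  where
  y : Triple ℕ
  y = y₀ , y₁ , y₂
  at : (∃ λ j → 3 + j ≡ r) →
    (OddCase y → N*/2^2r y r ≡ 1ℚ) ×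
    (EvenCase₀ y → N*/2^2r y r ≡ + 2 / 1) ×
    (EvenCase₁ y → N*/2^2r y r ≡ + 2 / 1) ×
    (EvenCase₂ y → N*/2^2r y r ≡ + 2 / 1) ×
    (¬ (OddCase y ⊎ EvenCase₀ y ⊎ EvenCase₁ y ⊎ EvenCase₂ y) → N*/2^2r y r ≡ 0ℚ)
  at (j , refl) = odd-case y₀ y₁ y₂ sf j , even-case₀ y₀ y₁ y₂ sf j , even-case₁ y₀ y₁ y₂ sf j
    , even-case₂ y₀ y₁ y₂ sf j , other-case y₀ y₁ y₂ sf j
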